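{- For every (constant) integer $k\ge 2$, there is a polynomial time algorithm that decides whether a complete instance of $k$-CSP (over the Boolean alphabet) is satisfiable or not.
   Context: A complete (Boolean) $k$-CSP instance is a pair $\mathcal{I}=(V,\mathcal{P})$ where $V$ is a finite set of variables taking values in $\{0,1\}$ and $\mathcal{P}$ contains exactly one constraint $P_S:\{0,1\}^S\to\{0,1\}$ for every $S\in\binom{V}{k}$ (value $1$ means satisfied, $0$ means unsatisfied), where each $P_S$ is nontrivial: it is unsatisfied for at least one assignment in $\{0,1\}^S$. The instance is satisfiable if there is $\alpha\in\{0,1\}^V$ such that $P_S(\alpha_S)=1$ for all $S\in\binom{V}{k}$, where $\alpha_S$ is the restriction of $\alpha$ to $S$. Polynomial time means polynomial in $n=|V|$ for each fixed $k$. -}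

module Defs where

open import Data.Bool.Base using (Bool; true; false)
open import Data.Fin.Base using (Fin; zero; suc)
open import Data.Fin.Subset using (Subset; ∣_∣; inside; outside)
open import Data.List.Base using (List; []; _∷_; _++_; map; concatMap; replicate)
open import Data.Maybe.Base using (Maybe; just; nothing)
open import Data.Nat.Base using (ℕ; zero; suc)
open import Data.Product.Base using (Σ; ∃; _×_; _,_)
open import Data.Sum.Base using (_⊎_; inj₁; inj₂)
open import Data.Vec.Base as Vec using (Vec; []; _∷_)
open import Function.Bundles using (_↔_)
open import Relation.Binary.PropositionalEquality using (_≡_; refl; cong)

-- Complete Boolean k-CSP instances, with variable set V = Fin n.

record KSubset (n k : ℕ) : Set where
  constructor _of-size_
  field
    members : Subset n
    .size   : ∣ members ∣ ≡ k

open KSubset public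

-- {0,1}^S is represented by listing the values on S in increasing order of
-- the elements of S; under this identification `restrict α S` is α_S.
restrict : ∀ {n} → Vec Bool n → (S : Subset n) → Vec Bool ∣ S ∣
restrict []      []            = []
restrict (b ∷ α) (inside  ∷ S) = b ∷ restrict α S
restrict (b ∷ α) (outside ∷ S) = restrict α S

record CompleteCSP (k n : ℕ) : Set where
  field
    P          : (S : KSubset n k) → Vec Bool ∣ members S ∣ → Bool
    nontrivial : ∀ S → ∃ λ a → P S a ≡ false

open CompleteCSP public

Satisfiable : ∀ {k n} → CompleteCSP k n → Set
Satisfiable {k} {n} I =
  ∃ λ (α : Vec Bool n) → ∀ S → P I S (restrict α (members S)) ≡ true

-- Encoding of instances as binary words: 1ⁿ0, followed, for each k-subset S,
-- by the characteristic vector of S (n bits) and the truth table of P_S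
-- (2ᵏ bits, assignments in lexicographic order).

kSubsets : ∀ n k → List (KSubset n k)
kSubsets zero    zero    = ([] of-size refl) ∷ []
kSubsets zero    (suc k) = []
kSubsets (suc n) zero    =
  map (λ (S of-size p) → (outside ∷ S) of-size p) (kSubsets n zero)
kSubsets (suc n) (suc k) =
  map (λ (S of-size p) → (inside ∷ S) of-size cong suc p) (kSubsets n k)
  ++ map (λ (S of-size p) → (outside ∷ S) of-size p) (kSubsets n (suc k))

assignments : ∀ m → List (Vec Bool m)
assignments zero    = [] ∷ []
assignments (suc m) =
  map (false ∷_) (assignments m) ++ map (true ∷_) (assignments m)

encode : ∀ {k n} → CompleteCSP k n → List Bool
encode {k} {n} I =
  replicate n true ++ false ∷ concatMap constraint (kSubsets n k)
  where
  constraint : KSubset n k → List Bool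
  constraint S =
    Vec.toList (members S) ++ map (P I S) (assignments ∣ members S ∣)

-- Deterministic multi-tape Turing machines with input alphabet Bool.

Finite : Set → Set
Finite A = ∃ λ n → A ↔ Fin n

data Move : Set where
  left stay right : Move

-- A two-way infinite tape that is blank outside a finite window. `before`
-- lists the cells to the left of the head starting with the nearest one,
-- `after` those to the right; all cells beyond these lists are blank.
record Tape (Γ : Set) : Set where
  constructor tape
  field
    before : List (Maybe Γ)
    head   : Maybe Γ
    after  : List (Maybe Γ)

pattern blank = nothing

move : ∀ {Γ} → Move → Tape Γ → Tape Γ
move left  (tape []       h rs)       = tape [] blank (h ∷ rs)
move left  (tape (l ∷ ls) h rs)       = tape ls l (h ∷ rs)
move stay  t                          = t
move right (tape ls       h [])       = tape (h ∷ ls) blank []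
move right (tape ls       h (r ∷ rs)) = tape (h ∷ ls) r rs

act : ∀ {Γ} → Maybe Γ × Move → Tape Γ → Tape Γ
act (c , m) (tape ls _ rs) = move m (tape ls c rs)

inputTape : ∀ {Γ} → List (Maybe Γ) → Tape Γ
inputTape []       = tape [] blank []
inputTape (c ∷ cs) = tape [] c cs

record TM : Set₁ where
  field
    Work State   : Set
    work-finite  : Finite Work
    state-finite : Finite State
    extraTapes   : ℕ
    start        : State
    -- `just true` marks accepting states, `just false` rejecting ones; the
    -- machine halts on reaching either.
    verdict      : State → Maybe Bool

  Symbol : Set
  Symbol = Bool ⊎ Work

  Cell : Set
  Cell = Maybe Symbol

  tapes : ℕ
  tapes = suc extraTapes

  field
    δ : State → Vec Cell tapes → State × Vec (Cell × Move) tapes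

module _ (M : TM) where
  open TM M

  Config : Set
  Config = State × Vec (Tape Symbol) tapes

  initial : List Bool → Config
  initial w =
    start , inputTape (map (λ b → just (inj₁ b)) w)
            ∷ Vec.replicate extraTapes (inputTape [])

  step : Config → Config
  step (q , ts) with δ q (Vec.map Tape.head ts)
  ... | q′ , as = q′ , Vec.zipWith act as ts

  runFrom : ℕ → Config → Maybe Bool
  runFrom t       (q , ts) with verdict q
  runFrom t       (q , ts) | just b  = just b
  runFrom zero    (q , ts) | nothing = nothing
  runFrom (suc t) (q , ts) | nothing = runFrom t (step (q , ts))

  -- The verdict on input w if M halts within t steps, `nothing` otherwise.
  run : ℕ → List Bool → Maybe Bool
  run t w = runFrom t (initial w)

{-# OPTIONS --safe #-}

-- Since every constraint is falsified by some pattern, the satisfying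
-- assignments of a complete instance on i variables shatter no k-set, so by
-- the Sauer–Shelah lemma there are at most (i+1)ᵏ of them. The constraints
-- lying inside the last i variables form again a complete instance. Hence a
-- backtracking search that assigns the variables from the last to the first,
-- and cuts off as soon as a constraint with all variables assigned fails,
-- meets polynomially many partial assignments. A two-tape Turing machine runs
-- this search: the second tape holds the partial assignment, and one pass over
-- the input checks it, with the restriction to the current k-set and the
-- matching truth-table row kept in the finite control.
module Submission where

open import Defs
open import Data.Bool.Base using (Bool; true; false; if_then_else_; not; _∧_; _∨_)
open import Data.Bool.ListAction using (all)
open import Data.Bool.Properties as Bool using ()
open import Data.Fin.Base using (Fin; zero; suc)
open import Data.Fin.Properties using (1↔⊤; 2↔Bool; +↔⊎; *↔×)
open import Data.Fin.Subset using (Subset; ∣_∣; inside; outside)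
open import Data.List.Base using (List; []; _∷_; _++_; _ʳ++_; concatMap; length; map; replicate)
open import Data.List.Membership.Propositional using (_∈_)
open import Data.List.Membership.Propositional.Properties using (∈-map⁺; ∈-++⁺ˡ; ∈-++⁺ʳ)
open import Data.List.Properties
  using (length-map; length-++; length-ʳ++; length-replicate; ++-ʳ++; ʳ++-ʳ++; ++-assoc; ++-identityʳ; ≡-dec)
open import Data.List.Relation.Unary.Any using (here; there)
open import Data.Maybe.Base as Maybe using (Maybe; just; nothing; maybe′)
open import Data.Nat.Base
open import Data.Nat.Properties
open import Data.Nat.Tactic.RingSolver using (solve-∀)
open import Data.Product.Base using (∃; _×_; _,_; proj₁; proj₂; map₂)
open import Data.Product.Function.NonDependent.Propositional using (_×-↔_)
open import Data.Sum.Base using (_⊎_; inj₁; inj₂)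
open import Data.Sum.Function.Propositional using (_⊎-↔_)
open import Data.Unit.Base using (⊤; tt)
open import Data.Vec.Base as Vec using (Vec; []; _∷_)
open import Data.Vec.Properties using (cast-is-id; length-toList; toList-injective)
open import Function.Base using (_∘_)
open import Function.Bundles using (_↔_; mk↔ₛ′)
open import Function.Properties.Inverse using (↔-refl; ↔-sym; ↔-trans)
open import Relation.Binary.PropositionalEquality
open import Relation.Nullary using (contradiction; yes; no; recompute)
open import Relation.Nullary.Decidable using (⌊_⌋)
open import Relation.Nullary.Reflects using (Reflects; ofʸ; ofⁿ)

-- Boolean conjunctions over lists

∧-true : ∀ {a b} → a ∧ b ≡ true → a ≡ true × b ≡ true
∧-true {true} {true} refl = refl , refl

all-++ : ∀ {A : Set} (f : A → Bool) xs {ys} → all f (xs ++ ys) ≡ all f xs ∧ all f ys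
all-++ f []       = refl
all-++ f (x ∷ xs) with f x
... | true  = all-++ f xs
... | false = refl

all-map : ∀ {A B : Set} (f : B → Bool) (g : A → B) xs → all f (map g xs) ≡ all (f ∘ g) xs
all-map f g []       = refl
all-map f g (x ∷ xs) = cong (f (g x) ∧_) (all-map f g xs)

all-true : ∀ {A : Set} {f : A → Bool} → (∀ x → f x ≡ true) → ∀ xs → all f xs ≡ true
all-true p []       = refl
all-true p (x ∷ xs) = cong₂ _∧_ (p x) (all-true p xs)

all-lookup : ∀ {A : Set} {f : A → Bool} {x xs} → x ∈ xs → all f xs ≡ true → f x ≡ true
all-lookup (here refl) p = proj₁ (∧-true p)
all-lookup {f = f} (there x∈) p = all-lookup x∈ (proj₂ (∧-true {f _} p))

-- Sums over Boolean vectors and the Sauer–Shelah bound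

∑ : ∀ n → (Vec Bool n → ℕ) → ℕ
∑ zero    f = f []
∑ (suc n) f = ∑ n (f ∘ (false ∷_)) + ∑ n (f ∘ (true ∷_))

∑-mono : ∀ n {f g} → (∀ p → f p ≤ g p) → ∑ n f ≤ ∑ n g
∑-mono zero    f≤g = f≤g []
∑-mono (suc n) f≤g = +-mono-≤ (∑-mono n (f≤g ∘ _)) (∑-mono n (f≤g ∘ _))

+-interchange : ∀ a b c d → (a + b) + (c + d) ≡ (a + c) + (b + d)
+-interchange = solve-∀

∑-+ : ∀ n f g → ∑ n (λ p → f p + g p) ≡ ∑ n f + ∑ n g
∑-+ zero    f g = refl
∑-+ (suc n) f g
  rewrite ∑-+ n (f ∘ (false ∷_)) (g ∘ (false ∷_)) | ∑-+ n (f ∘ (true ∷_)) (g ∘ (true ∷_))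
  = +-interchange (∑ n (f ∘ (false ∷_))) _ _ _

∑-* : ∀ n c f → ∑ n (λ p → c * f p) ≡ c * ∑ n f
∑-* zero    c f = refl
∑-* (suc n) c f rewrite ∑-* n c (f ∘ (false ∷_)) | ∑-* n c (f ∘ (true ∷_)) =
  sym (*-distribˡ-+ c (∑ n (f ∘ (false ∷_))) _)

bit : Bool → ℕ
bit b = if b then 1 else 0

count : ∀ {n} → (Vec Bool n → Bool) → ℕ
count {n} F = ∑ n (bit ∘ F)

-- Inclusion-exclusion. With `F` and `G` the halves of a family split by its first coordinate, the
-- right side counts its projection and the points that lie in both halves.
count-∨-∧ : ∀ {n} (F G : Vec Bool n → Bool) →
  count F + count G ≡ count (λ p → F p ∨ G p) + count (λ p → F p ∧ G p)
count-∨-∧ {n} F G = begin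
  count F + count G                                       ≡⟨ ∑-+ n _ _ ⟨
  ∑ n (λ p → bit (F p) + bit (G p))                       ≡⟨ ∑-cong n (λ p → bits (F p) (G p)) ⟩
  ∑ n (λ p → bit (F p ∨ G p) + bit (F p ∧ G p))           ≡⟨ ∑-+ n _ _ ⟩
  count (λ p → F p ∨ G p) + count (λ p → F p ∧ G p)       ∎
  where
  open ≡-Reasoning
  ∑-cong : ∀ n {f g} → (∀ p → f p ≡ g p) → ∑ n f ≡ ∑ n g
  ∑-cong zero    f≡g = f≡g []
  ∑-cong (suc n) f≡g = cong₂ _+_ (∑-cong n (f≡g ∘ _)) (∑-cong n (f≡g ∘ _))
  bits : ∀ a b → bit a + bit b ≡ bit (a ∨ b) + bit (a ∧ b)
  bits false false = refl
  bits false true  = refl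
  bits true  false = refl
  bits true  true  = refl

-- That is, F shatters no k-set; the missing pattern is given explicitly.
Misses : ∀ k {n} → (Vec Bool n → Bool) → Set
Misses k {n} F =
  (S : KSubset n k) → ∃ λ a → ∀ p → F p ≡ true → restrict p (members S) ≢ a

∨-true : ∀ a {b} {C : Set} → (a ≡ true → C) → (b ≡ true → C) → a ∨ b ≡ true → C
∨-true true  f g _ = f refl
∨-true false f g p = g p

-- Restricting to a set that avoids the first coordinate does not see that coordinate, so the
-- pattern missed by `F` there stays missing.
Misses-∨ : ∀ {k n} {F : Vec Bool (suc n) → Bool} → Misses k F →
  Misses k (λ p → F (false ∷ p) ∨ F (true ∷ p))
Misses-∨ {F = F} miss (S of-size eq) with miss ((outside ∷ S) of-size eq)
... | a , a-missing = a , λ p → ∨-true (F (false ∷ p)) (a-missing _) (a-missing _)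

-- Add the first coordinate to the set and drop the first bit of the missing pattern. A point of
-- both halves that realised the rest would realise the whole pattern, whichever that bit is.
Misses-∧ : ∀ {k n} {F : Vec Bool (suc n) → Bool} → Misses (suc k) F →
  Misses k (λ p → F (false ∷ p) ∧ F (true ∷ p))
Misses-∧ {F = F} miss (S of-size eq) with miss ((inside ∷ S) of-size cong suc eq)
... | (false ∷ a) , a-missing = a , λ p F01 p≡a → a-missing _ (proj₁ (∧-true F01)) (cong (_ ∷_) p≡a)
... | (true ∷ a)  , a-missing =
  a , λ p F01 p≡a → a-missing _ (proj₂ (∧-true {F (false ∷ p)} F01)) (cong (_ ∷_) p≡a)

-- The left side unfolds to `suc x * x ^ k`. This closes the Pascal-type recurrences for
-- `sauer-shelah` and `length-kSubsets`.
pow-step : ∀ x k → x ^ k + x ^ suc k ≤ suc x ^ suc k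
pow-step x k = *-monoʳ-≤ (suc x) (^-monoˡ-≤ k (n≤1+n x))

-- The empty set has a single pattern, and every point realises it; missing it forces an empty
-- family.
Misses-0 : ∀ n (F : Vec Bool n → Bool) → Misses 0 F → count F ≡ 0
Misses-0 zero F miss with F [] in eq | miss ([] of-size refl)
... | false | _              = refl
... | true  | [] , a-missing = contradiction refl (a-missing [] eq)
Misses-0 (suc n) F miss = cong₂ _+_ (half false) (half true)
  where
  half : ∀ b → count (F ∘ (b ∷_)) ≡ 0
  half b = Misses-0 n _ λ { (S of-size eq) → map₂ (λ m p → m (b ∷ p)) (miss ((outside ∷ S) of-size eq)) }

-- Induction on the first coordinate: the projection misses a pattern on each set of the same size,
-- the intersection of the halves already on each set of size one less.
sauer-shelah : ∀ n k (F : Vec Bool n → Bool) → Misses k F → count F ≤ suc n ^ k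
sauer-shelah n zero F miss = ≤-trans (≤-reflexive (Misses-0 n F miss)) z≤n
sauer-shelah zero (suc k) F miss =
  ≤-trans (bit≤1 (F [])) (≤-reflexive (sym (^-zeroˡ (suc k))))
  where
  bit≤1 : ∀ b → bit b ≤ 1
  bit≤1 false = z≤n
  bit≤1 true  = ≤-refl
sauer-shelah (suc n) (suc k) F miss = begin
  count (F ∘ (false ∷_)) + count (F ∘ (true ∷_))            ≡⟨ count-∨-∧ {n} _ _ ⟩
  count {n} (λ p → F (false ∷ p) ∨ F (true ∷ p))
    + count {n} (λ p → F (false ∷ p) ∧ F (true ∷ p))        ≤⟨ +-mono-≤
      (sauer-shelah n (suc k) _ (Misses-∨ {F = F} miss)) (sauer-shelah n k _ (Misses-∧ {F = F} miss)) ⟩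
  suc n ^ suc k + suc n ^ k                                 ≡⟨ +-comm (suc n ^ suc k) _ ⟩
  suc n ^ k + suc n ^ suc k                                 ≤⟨ pow-step (suc n) k ⟩
  suc (suc n) ^ suc k                                       ∎
  where open ≤-Reasoning

-- Enumerations of k-subsets and assignments

length-kSubsets : ∀ n k → length (kSubsets n k) ≤ suc n ^ k
length-kSubsets zero    zero    = ≤-refl
length-kSubsets zero    (suc k) = z≤n
length-kSubsets (suc n) zero    =
  ≤-trans (≤-reflexive (length-map _ (kSubsets n zero))) (length-kSubsets n zero)
length-kSubsets (suc n) (suc k) = begin
  length (map _ (kSubsets n k) ++ map _ (kSubsets n (suc k)))            ≡⟨ length-++ (map _ (kSubsets n k)) ⟩
  length (map _ (kSubsets n k)) + length (map _ (kSubsets n (suc k)))    ≡⟨ cong₂ _+_ (length-map _ (kSubsets n k)) (length-map _ (kSubsets n (suc k))) ⟩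
  length (kSubsets n k) + length (kSubsets n (suc k))                    ≤⟨ +-mono-≤ (length-kSubsets n k) (length-kSubsets n (suc k)) ⟩
  suc n ^ k + suc n ^ suc k                                              ≤⟨ pow-step (suc n) k ⟩
  suc (suc n) ^ suc k                                                    ∎
  where open ≤-Reasoning

∈-kSubsets : ∀ {n k} (S : KSubset n k) → S ∈ kSubsets n k
∈-kSubsets (S of-size p) = go S p
  where
  go : ∀ {n k} (S : Subset n) .(p : ∣ S ∣ ≡ k) → (S of-size p) ∈ kSubsets n k
  go {k = zero}  []            p = here refl
  go {k = zero}  (outside ∷ S) p = ∈-map⁺ _ (go S p)
  go {k = suc k} (inside ∷ S)  p = ∈-++⁺ˡ (∈-map⁺ _ (go S (suc-injective p)))
  go {k = suc k} (outside ∷ S) p = ∈-++⁺ʳ (map _ (kSubsets _ k)) (∈-map⁺ _ (go S p))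

0<length-assignments : ∀ m → 0 < length (assignments m)
0<length-assignments zero = s≤s z≤n
0<length-assignments (suc m) with assignments m | 0<length-assignments m
... | _ ∷ _ | _ = s≤s z≤n

∈-assignments : ∀ {m} (a : Vec Bool m) → a ∈ assignments m
∈-assignments []          = here refl
∈-assignments (false ∷ a) = ∈-++⁺ˡ (∈-map⁺ _ (∈-assignments a))
∈-assignments (true  ∷ a) = ∈-++⁺ʳ (map _ (assignments _)) (∈-map⁺ _ (∈-assignments a))

-- Partial assignments

prestrict : ∀ {n} → Vec (Maybe Bool) n → (S : Subset n) → Maybe (Vec Bool ∣ S ∣)
prestrict []      []            = just []
prestrict (x ∷ σ) (inside  ∷ S) = Maybe.zipWith _∷_ x (prestrict σ S)
prestrict (x ∷ σ) (outside ∷ S) = prestrict σ S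

prestrict-just : ∀ {n} (α : Vec Bool n) S → prestrict (Vec.map just α) S ≡ just (restrict α S)
prestrict-just []      []            = refl
prestrict-just (b ∷ α) (inside  ∷ S) rewrite prestrict-just α S = refl
prestrict-just (b ∷ α) (outside ∷ S) = prestrict-just α S

-- The default `true` means that a constraint with an unassigned variable never cuts off the search.
respects : ∀ {k n} → CompleteCSP k n → Vec (Maybe Bool) n → KSubset n k → Bool
respects I σ S = maybe′ (P I S) true (prestrict σ (members S))

consistent : ∀ {k n} → CompleteCSP k n → Vec (Maybe Bool) n → Bool
consistent {k} {n} I σ = all (respects I σ) (kSubsets n k)

consistent⇒ : ∀ {k n} (I : CompleteCSP k n) α → consistent I (Vec.map just α) ≡ true →
  ∀ S → P I S (restrict α (members S)) ≡ true
consistent⇒ I α ok S =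
  trans (sym (cong (maybe′ (P I S) true) (prestrict-just α (members S))))
        (all-lookup (∈-kSubsets S) ok)

⇒consistent : ∀ {k n} (I : CompleteCSP k n) α → (∀ S → P I S (restrict α (members S)) ≡ true) →
  consistent I (Vec.map just α) ≡ true
⇒consistent I α sat = all-true
  (λ S → trans (cong (maybe′ (P I S) true) (prestrict-just α (members S))) (sat S)) (kSubsets _ _)

-- The pattern missing on `S` is the assignment that falsifies `P I S`, which exists by
-- nontriviality.
count-consistent : ∀ {k n} (I : CompleteCSP k n) → count (consistent I ∘ Vec.map just) ≤ suc n ^ k
count-consistent {k} {n} I = sauer-shelah n k _ λ S →
  let a , Pa≡false = nontrivial I S in
  a , λ p ok p≡a →
    contradiction (trans (sym (consistent⇒ I p ok S)) (trans (cong (P I S) p≡a) Pa≡false)) λ ()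

-- Sub-instances on the last variables, and the levels of the search tree

tail : ∀ {k n} → CompleteCSP k (suc n) → CompleteCSP k n
tail I = record
  { P          = λ { (S of-size p) → P I ((outside ∷ S) of-size p) }
  ; nontrivial = λ { (S of-size p) → nontrivial I ((outside ∷ S) of-size p) }
  }

module _ {k n} (I : CompleteCSP (suc k) (suc n)) (x : Maybe Bool) (σ : Vec (Maybe Bool) n) where

  -- `kSubsets` lists the sets through the first variable before the others; `b` is the conjunction
  -- of the former constraints.
  consistent-∷ : ∃ λ b → consistent I (x ∷ σ) ≡ b ∧ consistent (tail I) σ
  consistent-∷ = _ , trans (all-++ _ (map _ (kSubsets n k)))
                           (cong₂ _∧_ refl (all-map _ _ (kSubsets n (suc k))))

  consistent-tail : consistent I (x ∷ σ) ≡ true → consistent (tail I) σ ≡ true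
  consistent-tail ok with consistent-∷
  ... | b , eq = proj₂ (∧-true {b} (trans (sym eq) ok))

-- Every set through an unassigned first variable restricts to `nothing`, so its constraint holds by
-- default.
consistent-nothing : ∀ {k n} (I : CompleteCSP (suc k) (suc n)) σ →
  consistent I (nothing ∷ σ) ≡ consistent (tail I) σ
consistent-nothing {k} {n} I σ = trans (all-++ _ (map _ (kSubsets n k))) (cong₂ _∧_
  (trans (all-map _ _ (kSubsets n k)) (all-true (λ _ → refl) (kSubsets n k)))
  (all-map _ _ (kSubsets n (suc k))))

-- e : i ⊑ n says that the last i of n variables form a level of the search
-- tree; `up` goes one level towards the root.
infix 4 _⊑_
data _⊑_ : ℕ → ℕ → Set where
  done : ∀ {n} → n ⊑ n
  up   : ∀ {i n} → suc i ⊑ n → i ⊑ n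

height : ∀ {i n} → i ⊑ n → ℕ
height done   = 0
height (up e) = suc (height e)

height-+ : ∀ {i n} (e : i ⊑ n) → height e + i ≡ n
height-+ done           = refl
height-+ {i} (up e) = trans (sym (+-suc (height e) i)) (height-+ e)

pad : ∀ {A : Set} {i n} → i ⊑ n → A → Vec A i → Vec A n
pad done   x v = v
pad (up e) x v = pad e x (x ∷ v)

suffix : ∀ {A : Set} {i n} → i ⊑ n → Vec A n → Vec A i
suffix done   v = v
suffix (up e) v = Vec.tail (suffix e v)

tails : ∀ {k i n} → i ⊑ n → CompleteCSP k n → CompleteCSP k i
tails done   I = I
tails (up e) I = tail (tails e I)

root : ∀ {n} → 0 ⊑ n
root = descend done
  where
  descend : ∀ {i n} → i ⊑ n → 0 ⊑ n
  descend {zero}  e = e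
  descend {suc i} e = descend (up e)

replicate-++-∷ : ∀ {A : Set} r (x : A) {xs} → replicate r x ++ x ∷ xs ≡ x ∷ replicate r x ++ xs
replicate-++-∷ zero    x = refl
replicate-++-∷ (suc r) x = cong (x ∷_) (replicate-++-∷ r x)

toList-pad : ∀ {A : Set} {i n} (e : i ⊑ n) (x : A) v →
  Vec.toList (pad e x v) ≡ replicate (height e) x ++ Vec.toList v
toList-pad done   x v = refl
toList-pad (up e) x v = trans (toList-pad e x (x ∷ v)) (replicate-++-∷ (height e) x)

-- Size of the search tree

module Search {k n} (I : CompleteCSP (suc k) n) where

  alive : ∀ {i} → i ⊑ n → Vec Bool i → Bool
  alive e p = consistent (tails e I) (Vec.map just p)

  consistent-pad : ∀ {i} (e : i ⊑ n) σ → consistent I (pad e nothing σ) ≡ consistent (tails e I) σ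
  consistent-pad done   σ = refl
  consistent-pad (up e) σ =
    trans (consistent-pad e (nothing ∷ σ)) (consistent-nothing (tails e I) σ)

  -- Soundness of the cut-off: a solution lies below alive nodes only.
  alive-suffix : ∀ {i} (e : i ⊑ n) α → alive done α ≡ true → alive e (suffix e α) ≡ true
  alive-suffix done   α ok = ok
  alive-suffix (up e) α ok with suffix e α | alive-suffix e α ok
  ... | b ∷ p | ok′ = consistent-tail (tails e I) (just b) (Vec.map just p) ok′

  -- The cost of the search strictly below a node, when each visit costs c.
  -- Dead nodes are charged to their alive parent.
  load : ℕ → ∀ {i} → i ⊑ n → Vec Bool i → ℕ
  load c done   p = 0
  load c (up e) p =
    if alive (up e) p then (c + load c e (false ∷ p)) + (c + load c e (true ∷ p)) else 0

  -- Level by level: an alive node pays `2 * c` for its two children, `count-consistent` bounds the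
  -- alive nodes of the level, and the loads of all children sum to the term for the next level.
  ∑-load : ∀ c {i} (e : i ⊑ n) → ∑ i (load c e) ≤ height e * (2 * c * suc n ^ suc k)
  ∑-load c {i} done = ≤-reflexive (∑-0 i)
    where
    ∑-0 : ∀ i → ∑ i (λ _ → 0) ≡ 0
    ∑-0 zero    = refl
    ∑-0 (suc i) = cong₂ _+_ (∑-0 i) (∑-0 i)
  ∑-load c {i} (up e) = begin
    ∑ i (load c (up e))
      ≤⟨ ∑-mono i pointwise ⟩
    ∑ i (λ p → 2 * c * bit (alive (up e) p) + (load c e (false ∷ p) + load c e (true ∷ p)))
      ≡⟨ ∑-+ i _ _ ⟩
    ∑ i (λ p → 2 * c * bit (alive (up e) p)) + ∑ i (λ p → load c e (false ∷ p) + load c e (true ∷ p))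
      ≡⟨ cong₂ _+_ (∑-* i (2 * c) _) (∑-+ i _ _) ⟩
    2 * c * count (alive (up e)) + ∑ (suc i) (load c e)
      ≤⟨ +-mono-≤ (*-monoʳ-≤ (2 * c) (≤-trans (count-consistent (tails (up e) I))
           (^-monoˡ-≤ (suc k) (s≤s (≤-trans (m≤n+m i (height (up e))) (≤-reflexive (height-+ (up e))))))))
           (∑-load c e) ⟩
    2 * c * suc n ^ suc k + height e * (2 * c * suc n ^ suc k)
      ∎
    where
    open ≤-Reasoning
    regroup : ∀ c x y → (c + x) + (c + y) ≡ 2 * c * 1 + (x + y)
    regroup = solve-∀
    pointwise : ∀ p → load c (up e) p ≤ 2 * c * bit (alive (up e) p) + (load c e (false ∷ p) + load c e (true ∷ p))
    pointwise p with alive (up e) p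
    ... | true  = ≤-reflexive (regroup c _ _)
    ... | false = z≤n

  load-root : ∀ c → load c root [] ≤ n * (2 * c * suc n ^ suc k)
  load-root c = ≤-trans (∑-load c root) (*-monoˡ-≤ (2 * c * suc n ^ suc k) height≤n)
    where
    height≤n : height (root {n}) ≤ n
    height≤n = ≤-trans (m≤m+n _ 0) (≤-reflexive (height-+ root))

-- Polynomial bounds

-- The base `suc n` keeps powers monotone in the exponent even at `n = 0`, so sums and products of
-- bounds have the same form.
Polynomial : (ℕ → ℕ) → Set
Polynomial f = ∃ λ c → ∃ λ d → ∀ n → f n ≤ c * suc n ^ d

poly-const : ∀ a → Polynomial (λ _ → a)
poly-const a = a , 0 , λ n → ≤-reflexive (sym (*-identityʳ a))

poly-suc^ : ∀ d → Polynomial (λ n → suc n ^ d)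
poly-suc^ d = 1 , d , λ n → ≤-reflexive (sym (+-identityʳ _))

poly-id : Polynomial (λ n → n)
poly-id = 1 , 1 , λ n → ≤-trans (n≤1+n n) (≤-reflexive (sym (trans (+-identityʳ _) (*-identityʳ _))))

poly-≤ : ∀ {f g} → (∀ n → f n ≤ g n) → Polynomial g → Polynomial f
poly-≤ f≤g (c , d , g≤) = c , d , λ n → ≤-trans (f≤g n) (g≤ n)

infixl 6 _poly-+_
infixl 7 _poly-*_

_poly-+_ : ∀ {f g} → Polynomial f → Polynomial g → Polynomial (λ n → f n + g n)
_poly-+_ {f} {g} (c , d , f≤) (c′ , d′ , g≤) = c + c′ , d + d′ , λ n → begin
  f n + g n                                        ≤⟨ +-mono-≤ (f≤ n) (g≤ n) ⟩
  c * suc n ^ d + c′ * suc n ^ d′                  ≤⟨ +-mono-≤ (*-monoʳ-≤ c (^-monoʳ-≤ (suc n) (m≤m+n d d′))) (*-monoʳ-≤ c′ (^-monoʳ-≤ (suc n) (m≤n+m d′ d))) ⟩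
  c * suc n ^ (d + d′) + c′ * suc n ^ (d + d′)     ≡⟨ *-distribʳ-+ (suc n ^ (d + d′)) c c′ ⟨
  (c + c′) * suc n ^ (d + d′)                      ∎
  where open ≤-Reasoning

_poly-*_ : ∀ {f g} → Polynomial f → Polynomial g → Polynomial (λ n → f n * g n)
_poly-*_ {f} {g} (c , d , f≤) (c′ , d′ , g≤) = c * c′ , d + d′ , λ n → begin
  f n * g n                                        ≤⟨ *-mono-≤ (f≤ n) (g≤ n) ⟩
  c * suc n ^ d * (c′ * suc n ^ d′)                ≡⟨ regroup c _ c′ _ ⟩
  c * c′ * (suc n ^ d * suc n ^ d′)                ≡⟨ cong (c * c′ *_) (^-distribˡ-+-* (suc n) d d′) ⟨
  c * c′ * suc n ^ (d + d′)                        ∎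
  where
  open ≤-Reasoning
  regroup : ∀ a x b y → a * x * (b * y) ≡ a * b * (x * y)
  regroup = solve-∀

-- Finite types

finite-Fin : ∀ n → Finite (Fin n)
finite-Fin n = n , ↔-refl

finite-⊤ : Finite ⊤
finite-⊤ = 1 , ↔-sym 1↔⊤

finite-Bool : Finite Bool
finite-Bool = 2 , ↔-sym 2↔Bool

finite-⊎ : ∀ {A B} → Finite A → Finite B → Finite (A ⊎ B)
finite-⊎ (m , A↔m) (n , B↔n) = m + n , ↔-trans (A↔m ⊎-↔ B↔n) (↔-sym +↔⊎)

finite-× : ∀ {A B} → Finite A → Finite B → Finite (A × B)
finite-× (m , A↔m) (n , B↔n) = m * n , ↔-trans (A↔m ×-↔ B↔n) (↔-sym *↔×)

finite-Maybe : ∀ {A} → Finite A → Finite (Maybe A)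
finite-Maybe {A} fin with finite-⊎ finite-⊤ fin
... | n , ⊤⊎A↔n = n , ↔-trans Maybe↔⊤⊎ ⊤⊎A↔n
  where
  Maybe↔⊤⊎ : Maybe A ↔ (⊤ ⊎ A)
  Maybe↔⊤⊎ = mk↔ₛ′
    (λ { nothing → inj₁ tt ; (just a) → inj₂ a })
    (λ { (inj₁ _) → nothing ; (inj₂ a) → just a })
    (λ { (inj₁ _) → refl ; (inj₂ _) → refl })
    (λ { nothing → refl ; (just _) → refl })

-- Bit strings of length at most m.
Str : ℕ → Set
Str zero    = ⊤
Str (suc m) = Maybe (Bool × Str m)

finite-Str : ∀ m → Finite (Str m)
finite-Str zero    = finite-⊤
finite-Str (suc m) = finite-Maybe (finite-× finite-Bool (finite-Str m))

toList : ∀ m → Str m → List Bool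
toList zero    _              = []
toList (suc m) nothing        = []
toList (suc m) (just (b , s)) = b ∷ toList m s

-- Words longer than m are truncated.
fromList : ∀ m → List Bool → Str m
fromList zero    _       = tt
fromList (suc m) []      = nothing
fromList (suc m) (b ∷ l) = just (b , fromList m l)

toList-fromList : ∀ m {l} → length l ≤ m → toList m (fromList m l) ≡ l
toList-fromList zero    {[]}    _       = refl
toList-fromList (suc m) {[]}    _       = refl
toList-fromList (suc m) {b ∷ l} (s≤s p) = cong (b ∷_) (toList-fromList m p)

ʳ++-involutive : ∀ {A : Set} (xs : List A) → (xs ʳ++ []) ʳ++ [] ≡ xs
ʳ++-involutive xs = trans (ʳ++-ʳ++ xs) (++-identityʳ xs)

-- Tapes

at : ∀ {Γ : Set} → List (Maybe Γ) → List (Maybe Γ) → Tape Γ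
at ls []       = tape ls blank []
at ls (c ∷ cs) = tape ls c cs

inputTape-at : ∀ {Γ : Set} (cs : List (Maybe Γ)) → inputTape cs ≡ at [] cs
inputTape-at []       = refl
inputTape-at (_ ∷ _) = refl

move-right : ∀ {Γ : Set} ls (c : Maybe Γ) rs → move right (tape ls c rs) ≡ at (c ∷ ls) rs
move-right ls c []       = refl
move-right ls c (_ ∷ _) = refl

-- A tape whose nonblank part is the word xs ʳ++ ys, with the head on the
-- first letter of ys or, if ys is empty, on the blank behind the word.
module Window {Γ A : Set} (g : A → Γ) (far : List (Maybe Γ)) where

  window : List A → List A → Tape Γ
  window xs ys = at (map (just ∘ g) xs ++ blank ∷ far) (map (just ∘ g) ys ++ blank ∷ [])

  window-right : ∀ xs y ys →
    move right (tape (map (just ∘ g) xs ++ blank ∷ far) (just (g y)) (map (just ∘ g) ys ++ blank ∷ []))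
      ≡ window (y ∷ xs) ys
  window-right xs y ys = move-right _ _ (map (just ∘ g) ys ++ blank ∷ [])

  window-left : ∀ x xs ys → move left (window (x ∷ xs) ys) ≡ window xs (x ∷ ys)
  window-left x xs []      = refl
  window-left x xs (_ ∷ _) = refl

  window-left-blank : ∀ ys → move left (window [] ys) ≡ tape far blank (map (just ∘ g) ys ++ blank ∷ [])
  window-left-blank []      = refl
  window-left-blank (_ ∷ _) = refl

  window-right-blank : ∀ ys →
    move right (tape far blank (map (just ∘ g) ys ++ blank ∷ [])) ≡ window [] ys
  window-right-blank ys = move-right _ _ (map (just ∘ g) ys ++ blank ∷ [])

-- Timed runs

module Runs (M : TM) where
  open TM M

  infix 4 _⇒⟨_⟩_
  -- Quantifying over the remaining fuel `s` makes runs compose by adding times. The index `b` is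
  -- only an upper bound, so it can be weakened while the exact time stays hidden.
  record _⇒⟨_⟩_ (c : Config M) (b : ℕ) (d : Config M) : Set where
    constructor takes
    field
      time      : ℕ
      time≤     : time ≤ b
      runs-like : ∀ s → runFrom M (time + s) c ≡ runFrom M s d

  ⇒-refl : ∀ {c} → c ⇒⟨ 0 ⟩ c
  ⇒-refl = takes 0 z≤n λ _ → refl

  infixr 3 _⨾_
  _⨾_ : ∀ {c d e a b} → c ⇒⟨ a ⟩ d → d ⇒⟨ b ⟩ e → c ⇒⟨ a + b ⟩ e
  _⨾_ {c} (takes t t≤a c⇒d) (takes u u≤b d⇒e) =
    takes (t + u) (+-mono-≤ t≤a u≤b) λ s →
      trans (cong (λ v → runFrom M v c) (+-assoc t u s)) (trans (c⇒d (u + s)) (d⇒e s))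

  ⇒-weaken : ∀ {c d a b} → a ≤ b → c ⇒⟨ a ⟩ d → c ⇒⟨ b ⟩ d
  ⇒-weaken a≤b (takes t t≤a c⇒d) = takes t (≤-trans t≤a a≤b) c⇒d

  ⇒-step : ∀ {q ts q′ as d} → verdict q ≡ nothing → δ q (Vec.map Tape.head ts) ≡ (q′ , as) →
    (q′ , Vec.zipWith act as ts) ≡ d → (q , ts) ⇒⟨ 1 ⟩ d
  ⇒-step {q} {ts} {q′} {as} running δ≡ refl = takes 1 ≤-refl one
    where
    step≡ : step M (q , ts) ≡ (q′ , Vec.zipWith act as ts)
    step≡ rewrite δ≡ = refl
    one : ∀ s → runFrom M (suc s) (q , ts) ≡ runFrom M s (q′ , Vec.zipWith act as ts)
    one s rewrite running = cong (runFrom M s) step≡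

  ⇒-halt : ∀ {w q ts b a T} → verdict q ≡ just b → initial M w ⇒⟨ a ⟩ (q , ts) → a ≤ T →
    run M T w ≡ just b
  ⇒-halt {w} {q} {ts} {b} {a} {T} halted (takes t t≤a c⇒d) a≤T =
    trans (cong (λ v → runFrom M v (initial M w)) (sym (m+[n∸m]≡n (≤-trans t≤a a≤T))))
          (trans (c⇒d (T ∸ t)) (halts (T ∸ t)))
    where
    halts : ∀ s → runFrom M s (q , ts) ≡ just b
    halts zero    rewrite halted = refl
    halts (suc s) rewrite halted = refl

-- The machine

Target : Set
Target = Fin 3

pattern next      = zero
pattern extend    = suc zero
pattern backtrack = suc (suc zero)

-- `rewind t` takes the input head back to the first cell, then `rewind₂ t` the
-- head of the second tape, and the machine goes on with t. In `members⟨ r ⟩`, r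
-- holds the values of the members read so far, or nothing if one of them is
-- unassigned. In `table⟨ s ⟩`, s says which of the remaining truth-table
-- entries belongs to the current assignment.
pattern setup        = inj₁ zero
pattern erase        = inj₁ (suc zero)
pattern seekEnd      = inj₁ (suc (suc zero))
pattern guess        = inj₁ (suc (suc (suc zero)))
pattern accept       = inj₁ (suc (suc (suc (suc zero))))
pattern reject       = inj₁ (suc (suc (suc (suc (suc zero)))))
pattern rewind t     = inj₂ (inj₁ t)
pattern rewind₂ t    = inj₂ (inj₂ (inj₁ t))
pattern members⟨_⟩ r = inj₂ (inj₂ (inj₂ (inj₁ r)))
pattern table⟨_⟩ s   = inj₂ (inj₂ (inj₂ (inj₂ (inj₁ s))))
pattern extending    = inj₂ (inj₂ (inj₂ (inj₂ (inj₂ false))))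
pattern backtracking = inj₂ (inj₂ (inj₂ (inj₂ (inj₂ true))))

-- The symbol inj₂ tt marks an unassigned variable.
symbol : Maybe Bool → Bool ⊎ ⊤
symbol (just b) = inj₁ b
symbol nothing  = inj₂ tt

module Input far = Window {Γ = Bool ⊎ ⊤} {A = Bool} inj₁ far
module Assigned  = Window symbol []
open Assigned using () renaming (window to assigned)

module Machine (k : ℕ) where

  tableLength : ℕ
  tableLength = length (assignments k)

  State : Set
  State = Fin 6 ⊎ Target ⊎ Target ⊎ Maybe (Str k) ⊎ Str tableLength ⊎ Bool

  Cell : Set
  Cell = Maybe (Bool ⊎ ⊤)

  Action : Set
  Action = State × Vec (Cell × Move) 2

  enter : Target → State
  enter next      = members⟨ just (fromList k []) ⟩
  enter extend    = extending
  enter backtrack = backtracking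

  outcome : Bool → State
  outcome ok = enter (if ok then extend else backtrack)

  append : Bool ⊎ ⊤ → Maybe (Str k) → Maybe (Str k)
  append (inj₁ b) (just s) = just (fromList k (toList k s ++ b ∷ []))
  append _        _        = nothing

  record-value : Bool ⊎ ⊤ → Bool ⊎ ⊤ → Maybe (Str k) → Maybe (Str k)
  record-value (inj₁ true) y r = append y r
  record-value _           _ r = r

  -- With an unassigned member no row is selected, so no table entry can be violated; this matches
  -- the default in `respects`.
  selects : Maybe (Str k) → Vec Bool k → Bool
  selects nothing  a = false
  selects (just s) a = ⌊ ≡-dec Bool._≟_ (toList k s) (Vec.toList a) ⌋

  mask : Maybe (Str k) → Str tableLength
  mask r = fromList tableLength (map (selects r) (assignments k))

  violates : Bool → Cell → Bool
  violates m (just (inj₁ b)) = m ∧ not b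
  violates m _               = false

  infix 2 _▹_/_
  _▹_/_ : State → Cell × Move → Cell × Move → Action
  q ▹ a / b = q , a ∷ b ∷ []

  -- An exhausted mask ends the block: the input head already stands behind it, and only the second
  -- head is rewound. A violated entry rewinds both heads.
  table-δ : List Bool → Cell → Cell → Action
  table-δ []       c d = rewind₂ next ▹ c , stay / d , left
  table-δ (m ∷ ms) c d =
    if violates m c
    then (rewind backtrack ▹ c , left / d , stay)
    else (table⟨ fromList tableLength ms ⟩ ▹ c , right / d , stay)

  δ : State → Vec Cell 2 → Action
  -- The prefix 1ⁿ0 of the input is blanked, so that a blank marks the start of
  -- the list of constraints when the head is rewound.
  δ setup          (c ∷ d ∷ [])                     = erase ▹ c , stay / d , right
  δ erase          (just (inj₁ true) ∷ d ∷ [])      = erase ▹ blank , right / just (inj₂ tt) , right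
  δ erase          (_ ∷ d ∷ [])                     = seekEnd ▹ blank , right / d , stay
  δ seekEnd        (just x ∷ d ∷ [])                = seekEnd ▹ just x , right / d , stay
  δ seekEnd        (blank ∷ d ∷ [])                 = rewind next ▹ blank , left / d , stay
  δ (rewind t)     (just x ∷ d ∷ [])                = rewind t ▹ just x , left / d , stay
  δ (rewind t)     (blank ∷ d ∷ [])                 = rewind₂ t ▹ blank , right / d , left
  δ (rewind₂ t)    (c ∷ just y ∷ [])                = rewind₂ t ▹ c , stay / just y , left
  δ (rewind₂ t)    (c ∷ blank ∷ [])                 = enter t ▹ c , stay / blank , right
  δ members⟨ r ⟩   (blank ∷ d ∷ [])                 = rewind extend ▹ blank , left / d , stay
  δ members⟨ r ⟩   (just x ∷ just y ∷ [])           = members⟨ record-value x y r ⟩ ▹ just x , right / just y , right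
  δ members⟨ r ⟩   (just x ∷ blank ∷ [])            = table⟨ mask r ⟩ ▹ just x , stay / blank , stay
  δ table⟨ s ⟩     (c ∷ d ∷ [])                     = table-δ (toList tableLength s) c d
  δ extending      (c ∷ just (inj₂ _) ∷ [])         = extending ▹ c , stay / just (inj₂ tt) , right
  δ extending      (c ∷ d ∷ [])                     = guess ▹ c , stay / d , left
  -- A blank here is the cell left of the window: no variable is unassigned.
  δ guess          (c ∷ just _ ∷ [])                = rewind₂ next ▹ c , stay / just (inj₁ false) , left
  δ guess          (c ∷ blank ∷ [])                 = accept ▹ c , stay / blank , stay
  δ backtracking   (c ∷ just (inj₁ false) ∷ [])     = rewind₂ next ▹ c , stay / just (inj₁ true) , left
  -- This skips the unassigned prefix and also resets a variable whose values are both exhausted.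
  δ backtracking   (c ∷ just _ ∷ [])                = backtracking ▹ c , stay / just (inj₂ tt) , right
  δ backtracking   (c ∷ blank ∷ [])                 = reject ▹ c , stay / blank , stay
  δ accept         (c ∷ d ∷ [])                     = accept ▹ c , stay / d , stay
  δ reject         (c ∷ d ∷ [])                     = reject ▹ c , stay / d , stay

  verdict : State → Maybe Bool
  verdict accept = just true
  verdict reject = just false
  verdict _      = nothing

  M : TM
  M = record
    { Work         = ⊤
    ; State        = State
    ; work-finite  = finite-⊤
    ; state-finite = finite-⊎ (finite-Fin 6) (finite-⊎ (finite-Fin 3) (finite-⊎ (finite-Fin 3)
                       (finite-⊎ (finite-Maybe (finite-Str k)) (finite-⊎ (finite-Str tableLength) finite-Bool))))
    ; extraTapes   = 1
    ; start        = setup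
    ; verdict      = verdict
    ; δ            = δ
    }

  -- Runs of the single phases

  open Runs M

  config : State → Tape (Bool ⊎ ⊤) → Tape (Bool ⊎ ⊤) → Config M
  config q X Y = q , X ∷ Y ∷ []

  -- The run starts after a left move because every transition into `rewind₂` makes one; this also
  -- covers a head on the blank behind the word.
  rewind₂-run : ∀ t X zs ws →
    config (rewind₂ t) X (move left (assigned zs ws)) ⇒⟨ suc (length zs) ⟩
      config (enter t) X (assigned [] (zs ʳ++ ws))
  rewind₂-run t X [] ws rewrite Assigned.window-left-blank ws =
    ⇒-step refl refl (cong (config (enter t) X) (Assigned.window-right-blank ws))
  rewind₂-run t X (z ∷ zs) ws rewrite Assigned.window-left z zs ws =
    ⇒-step refl refl refl ⨾ rewind₂-run t X zs (z ∷ ws)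

  module Phases (far : List Cell) where
    open Input far

    rewind-run : ∀ t xs ys zs ws →
      config (rewind t) (move left (window xs ys)) (assigned zs ws)
        ⇒⟨ suc (length xs) + suc (length zs) ⟩
      config (enter t) (window [] (xs ʳ++ ys)) (assigned [] (zs ʳ++ ws))
    rewind-run t [] ys zs ws rewrite window-left-blank ys =
      ⇒-step refl refl (cong (λ X → config (rewind₂ t) X (move left (assigned zs ws))) (window-right-blank ys))
      ⨾ rewind₂-run t _ zs ws
    rewind-run t (x ∷ xs) ys zs ws rewrite window-left x xs ys =
      ⇒-step refl refl refl ⨾ rewind-run t xs (x ∷ ys) zs ws

    scan : ∀ {m} → Maybe (Str k) → Subset m → Vec (Maybe Bool) m → Maybe (Str k)
    scan r []      []      = r
    scan r (b ∷ S) (x ∷ σ) = scan (record-value (inj₁ b) (symbol x) r) S σ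

    members-run : ∀ {m} r (S : Subset m) σ xs ys zs →
      config members⟨ r ⟩ (window xs (Vec.toList S ++ ys)) (assigned zs (Vec.toList σ)) ⇒⟨ m ⟩
        config members⟨ scan r S σ ⟩ (window (Vec.toList S ʳ++ xs) ys) (assigned (Vec.toList σ ʳ++ zs) [])
    members-run r []      []      xs ys zs = ⇒-refl
    members-run r (b ∷ S) (x ∷ σ) xs ys zs =
      ⇒-step refl refl (cong₂ (config _) (window-right xs b _) (Assigned.window-right zs x _))
      ⨾ members-run _ S σ (b ∷ xs) ys (x ∷ zs)

    module _ {A : Set} (g f : A → Bool) where

      passes : A → Bool
      passes a = not (g a ∧ not (f a))

      table-step : ∀ a as {b} → length (map g (a ∷ as)) ≤ tableLength → g a ∧ not (f a) ≡ b → ∀ {d} →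
        table-δ (toList tableLength (fromList tableLength (map g (a ∷ as)))) (just (inj₁ (f a))) d ≡
          (if b
           then (rewind backtrack ▹ just (inj₁ (f a)) , left / d , stay)
           else (table⟨ fromList tableLength (map g as) ⟩ ▹ just (inj₁ (f a)) , right / d , stay))
      table-step a as fits refl = cong (λ l → table-δ l _ _) (toList-fromList tableLength fits)

      table-pass : ∀ as xs ys Y → length (map g as) ≤ tableLength → all passes as ≡ true →
        config table⟨ fromList tableLength (map g as) ⟩ (window xs (map f as ++ ys)) Y
          ⇒⟨ suc (length as) ⟩
        config (rewind₂ next) (window (map f as ʳ++ xs) ys) (move left Y)
      table-pass [] xs ys Y fits _ =
        ⇒-step refl (cong (λ l → table-δ l _ _) (toList-fromList tableLength fits)) refl
      table-pass (a ∷ as) xs ys Y fits ok with g a ∧ not (f a) in eq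
      ... | false =
        ⇒-step refl (table-step a as fits eq) (cong (λ X → config _ X Y) (window-right xs (f a) _))
        ⨾ table-pass as (f a ∷ xs) ys Y (≤-trans (n≤1+n _) fits) ok

      -- The time covers reading at most `length as` entries, then rewinding over these and `xs` on
      -- the input and over `zs` on the second tape.
      table-fail : ∀ as xs ys zs ws → length (map g as) ≤ tableLength → all passes as ≡ false →
        config table⟨ fromList tableLength (map g as) ⟩ (window xs (map f as ++ ys)) (assigned zs ws)
          ⇒⟨ length as + (suc (length xs + length as) + suc (length zs)) ⟩
        config backtracking (window [] (xs ʳ++ (map f as ++ ys))) (assigned [] (zs ʳ++ ws))
      table-fail (a ∷ as) xs ys zs ws fits bad with g a ∧ not (f a) in eq
      ... | true = ⇒-weaken
        (s≤s (≤-trans (+-monoˡ-≤ (suc (length zs)) (s≤s (m≤m+n (length xs) _))) (m≤n+m _ (length as))))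
        (⇒-step refl (table-step a as fits eq) refl ⨾ rewind-run backtrack xs (f a ∷ _) zs ws)
      ... | false = ⇒-weaken
        (≤-reflexive (cong (λ l → suc (length as + (suc l + suc (length zs)))) (sym (+-suc (length xs) _))))
        (⇒-step refl (table-step a as fits eq)
           (cong (λ X → config _ X (assigned zs ws)) (window-right xs (f a) _))
         ⨾ table-fail as (f a ∷ xs) ys zs ws (≤-trans (n≤1+n _) fits) bad)

    scan-nothing : ∀ {m} (S : Subset m) σ → scan nothing S σ ≡ nothing
    scan-nothing []            []            = refl
    scan-nothing (inside  ∷ S) (just _  ∷ σ) = scan-nothing S σ
    scan-nothing (inside  ∷ S) (nothing ∷ σ) = scan-nothing S σ
    scan-nothing (outside ∷ S) (_       ∷ σ) = scan-nothing S σ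

    -- The length hypothesis guarantees that `fromList k` never truncates, so the register really
    -- appends.
    scan-just : ∀ {m} l (S : Subset m) σ → length l + ∣ S ∣ ≤ k →
      scan (just (fromList k l)) S σ ≡ Maybe.map (λ v → fromList k (l ++ Vec.toList v)) (prestrict σ S)
    scan-just l []            []            fits = cong (just ∘ fromList k) (sym (++-identityʳ l))
    scan-just l (outside ∷ S) (x ∷ σ)       fits = scan-just l S σ fits
    scan-just l (inside  ∷ S) (nothing ∷ σ) fits = scan-nothing S σ
    scan-just l (inside  ∷ S) (just b ∷ σ)  fits
      rewrite toList-fromList k {l} (≤-trans (m≤m+n _ _) fits)
            | scan-just (l ++ b ∷ []) S σ (≤-trans (≤-reflexive (trans
                (cong (_+ ∣ S ∣) (length-++ l)) (+-assoc (length l) 1 _))) fits)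
      with prestrict σ S
    ... | nothing = refl
    ... | just v  = cong (just ∘ fromList k) (++-assoc l (b ∷ []) (Vec.toList v))

    answer : ∀ {m} → Maybe (Vec Bool m) → Maybe (Str k)
    answer = Maybe.map (fromList k ∘ Vec.toList)

    -- Only the row equal to the restriction is tested; all others pass vacuously.
    passes-selected : ∀ (f : Vec Bool k → Bool) r →
      all (passes (selects (answer r)) f) (assignments k) ≡ maybe′ f true r
    passes-selected f nothing  = all-true (λ _ → refl) (assignments k)
    passes-selected f (just v) = decide (f v) refl
      where
      passed : Vec Bool k → Bool
      passed = passes (selects (just (fromList k (Vec.toList v)))) f
      selected : toList k (fromList k (Vec.toList v)) ≡ Vec.toList v
      selected = toList-fromList k (≤-reflexive (length-toList v))
      decide : ∀ b → f v ≡ b → all passed (assignments k) ≡ b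
      decide true fv = all-true passes-true (assignments k)
        where
        passes-true : ∀ a → passed a ≡ true
        passes-true a with ≡-dec Bool._≟_ (toList k (fromList k (Vec.toList v))) (Vec.toList a)
        ... | no _   = refl
        ... | yes eq = cong not (cong not
          (trans (cong f (trans (sym (cast-is-id refl a)) (toList-injective refl a v (trans (sym eq) selected)))) fv))
      -- The row of `v` occurs in the list and fails, so the conjunction cannot be true.
      decide false fv with all passed (assignments k) in eq
      ... | false = refl
      ... | true  = contradiction (trans (sym (all-lookup (∈-assignments v) eq)) v-fails) λ ()
        where
        v-fails : passed v ≡ false
        v-fails with ≡-dec Bool._≟_ (toList k (fromList k (Vec.toList v))) (Vec.toList v)
        ... | yes _ = cong (not ∘ not) fv
        ... | no ≢v = contradiction selected ≢v

    -- A nonempty table puts a letter under the input head; on a blank the machine would take the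
    -- input to be finished.
    switch : ∀ r (f : Vec Bool k → Bool) as → 0 < length as → ∀ xs ys zs →
      config members⟨ r ⟩ (window xs (map f as ++ ys)) (assigned zs []) ⇒⟨ 1 ⟩
        config table⟨ mask r ⟩ (window xs (map f as ++ ys)) (assigned zs [])
    switch r f (_ ∷ _) _ xs ys zs = ⇒-step refl refl refl

    mask-fits : ∀ r → length (map (selects r) (assignments k)) ≤ tableLength
    mask-fits r = ≤-reflexive (length-map (selects r) (assignments k))

    -- A variable `m` in place of the size of the set lets the equation be matched with `refl`.
    answer-pass : ∀ {m} → m ≡ k → ∀ (f : Vec Bool m → Bool) r xs ys zs → maybe′ f true r ≡ true →
      config members⟨ answer r ⟩ (window xs (map f (assignments m) ++ ys)) (assigned zs [])
        ⇒⟨ suc (suc (tableLength + suc (length zs))) ⟩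
      config (enter next) (window (map f (assignments m) ʳ++ xs) ys) (assigned [] (zs ʳ++ []))
    answer-pass refl f r xs ys zs ok =
      switch (answer r) f (assignments k) (0<length-assignments k) xs ys zs
      ⨾ table-pass (selects (answer r)) f (assignments k) xs ys _ (mask-fits (answer r))
          (trans (passes-selected f r) ok)
      ⨾ rewind₂-run next _ zs []

    answer-fail : ∀ {m} → m ≡ k → ∀ (f : Vec Bool m → Bool) r xs ys zs → maybe′ f true r ≡ false →
      config members⟨ answer r ⟩ (window xs (map f (assignments m) ++ ys)) (assigned zs [])
        ⇒⟨ suc (tableLength + (suc (length xs + tableLength) + suc (length zs))) ⟩
      config backtracking (window [] (xs ʳ++ (map f (assignments m) ++ ys))) (assigned [] (zs ʳ++ []))
    answer-fail refl f r xs ys zs bad =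
      switch (answer r) f (assignments k) (0<length-assignments k) xs ys zs
      ⨾ table-fail (selects (answer r)) f (assignments k) xs ys zs [] (mask-fits (answer r))
          (trans (passes-selected f r) bad)

    -- Checking a partial assignment against all constraints

    module Check {n} (I : CompleteCSP k n) where

      block : KSubset n k → List Bool
      block S = Vec.toList (members S) ++ map (P I S) (assignments ∣ members S ∣)

      -- The field `size` is irrelevant; decidable equality recovers a usable proof.
      card : (S : KSubset n k) → ∣ members S ∣ ≡ k
      card (S of-size p) = recompute (∣ S ∣ ≟ k) p

      length-block : ∀ S → length (block S) ≡ n + tableLength
      length-block S = trans (length-++ (Vec.toList (members S)))
        (cong₂ _+_ (length-toList (members S))
          (trans (length-map _ (assignments ∣ members S ∣)) (cong (length ∘ assignments) (card S))))

      -- Reading the members, the switch to the table, reading the table and leaving it, and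
      -- rewinding the second head.
      blockTime : ℕ
      blockTime = n + suc (suc (tableLength + suc n))

      module _ (σ : Vec (Maybe Bool) n) where

        scan-start : ∀ (S : KSubset n k) →
          scan (just (fromList k [])) (members S) σ ≡ answer (prestrict σ (members S))
        scan-start S = scan-just [] (members S) σ (≤-reflexive (card S))

        start : List Bool → List Bool → Config M
        start xs ys = config (enter next) (window xs ys) (assigned [] (Vec.toList σ))

        scanned : KSubset n k → List Bool → List Bool → Config M
        scanned S xs ys = config members⟨ answer (prestrict σ (members S)) ⟩
          (window (Vec.toList (members S) ʳ++ xs) (map (P I S) (assignments ∣ members S ∣) ++ ys))
          (assigned (Vec.toList σ ʳ++ []) [])

        scan-block : ∀ S xs ys → start xs (block S ++ ys) ⇒⟨ n ⟩ scanned S xs ys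
        scan-block S xs ys
          rewrite ++-assoc (Vec.toList (members S)) (map (P I S) (assignments ∣ members S ∣)) ys
                | sym (scan-start S) = members-run _ (members S) σ xs _ []

        length-σ : length (Vec.toList σ ʳ++ []) ≡ n
        length-σ = trans (length-ʳ++ (Vec.toList σ)) (trans (+-identityʳ _) (length-toList σ))

        block-pass : ∀ S xs ys → respects I σ S ≡ true →
          start xs (block S ++ ys) ⇒⟨ blockTime ⟩ start (block S ʳ++ xs) ys
        block-pass S xs ys ok
          with answer-pass (card S) (P I S) (prestrict σ (members S))
                 (Vec.toList (members S) ʳ++ xs) ys (Vec.toList σ ʳ++ []) ok
        ... | rest
          rewrite ++-ʳ++ (Vec.toList (members S)) {map (P I S) (assignments ∣ members S ∣)} {xs}
                | length-σ | ʳ++-involutive (Vec.toList σ) = scan-block S xs ys ⨾ rest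

        block-fail : ∀ S xs ys → respects I σ S ≡ false →
          start xs (block S ++ ys) ⇒⟨ blockTime + (length xs + length (block S)) ⟩
            config backtracking (window [] (xs ʳ++ (block S ++ ys))) (assigned [] (Vec.toList σ))
        block-fail S xs ys bad
          with answer-fail (card S) (P I S) (prestrict σ (members S))
                 (Vec.toList (members S) ʳ++ xs) ys (Vec.toList σ ʳ++ []) bad
        ... | rest
          rewrite ʳ++-ʳ++ (Vec.toList (members S)) {xs} {map (P I S) (assignments ∣ members S ∣) ++ ys}
                | sym (++-assoc (Vec.toList (members S)) (map (P I S) (assignments ∣ members S ∣)) ys)
                | length-σ | ʳ++-involutive (Vec.toList σ)
                | length-ʳ++ (Vec.toList (members S)) {xs} | length-toList (members S) | length-block S =
          ⇒-weaken (≤-reflexive (regroup n tableLength (length xs))) (scan-block S xs ys ⨾ rest)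
          where
          regroup : ∀ n a x → n + suc (a + (suc (n + x + a) + suc n)) ≡ n + suc (suc (a + suc n)) + (x + (n + a))
          regroup = solve-∀

        -- `N` bounds the part read plus the rest and pays for the one rewind of the input. The
        -- extra `blockTime` covers the constant overhead at the end of the input, or the work on a
        -- violated block.
        check : ∀ Ss xs N → length xs + length (concatMap block Ss) ≤ N →
          start xs (concatMap block Ss) ⇒⟨ length Ss * blockTime + (blockTime + N) ⟩
            config (outcome (all (respects I σ) Ss))
              (window [] (xs ʳ++ concatMap block Ss)) (assigned [] (Vec.toList σ))
        check [] xs N len = ⇒-weaken
          (≤-trans (≤-reflexive (regroup (length xs)))
            (+-mono-≤ {3} {blockTime} (≤-trans (s≤s (s≤s (≤-trans (s≤s z≤n) (m≤n+m (suc n) tableLength)))) (m≤n+m _ n))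
              (≤-trans (m≤m+n _ _) len)))
          (⇒-step refl refl refl ⨾ rewind-run extend xs [] [] (Vec.toList σ))
          where
          regroup : ∀ x → 1 + (suc x + 1) ≡ 3 + x
          regroup = solve-∀
        check (S ∷ Ss) xs N len with respects I σ S in eq
        ... | true =
          subst (λ ys → start xs (block S ++ concatMap block Ss) ⇒⟨ blockTime + length Ss * blockTime + (blockTime + N) ⟩
                          config (outcome (all (respects I σ) Ss)) (window [] ys) (assigned [] (Vec.toList σ)))
                (ʳ++-ʳ++ (block S))
                (⇒-weaken (≤-reflexive (sym (+-assoc blockTime _ _)))
                  (block-pass S xs (concatMap block Ss) eq ⨾ check Ss (block S ʳ++ xs) N len′))
          where
          regroup : ∀ a b c → a + b + c ≡ b + (a + c)
          regroup = solve-∀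
          len′ : length (block S ʳ++ xs) + length (concatMap block Ss) ≤ N
          len′ = ≤-trans (≤-reflexive (trans
            (cong (_+ length (concatMap block Ss)) (length-ʳ++ (block S) {xs}))
            (trans (regroup (length (block S)) _ _) (cong (length xs +_) (sym (length-++ (block S))))))) len
        ... | false = ⇒-weaken
          (≤-trans (+-monoʳ-≤ blockTime (≤-trans
              (+-monoʳ-≤ (length xs) (≤-trans (m≤m+n _ _) (≤-reflexive (sym (length-++ (block S)))))) len))
            (m≤n+m _ (blockTime + length Ss * blockTime)))
          (block-fail S xs (concatMap block Ss) eq)

-- The backtracking search on the machine

module Solve {k n : ℕ} (I : CompleteCSP (suc k) n) where
  open Search I
  open Machine (suc k)
  open Runs M

  -- The erased cells of the prefix 1ⁿ; the erased 0 is the blank that `window` puts next to the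
  -- word.
  far : List Cell
  far = replicate n blank ʳ++ []

  open Input far
  open Phases far
  open Check I

  word : List Bool
  word = concatMap block (kSubsets n (suc k))

  X : Tape (Bool ⊎ ⊤)
  X = window [] word

  us : ℕ → List (Maybe Bool)
  us r = replicate r nothing

  lits : ∀ {i} → Vec Bool i → List (Maybe Bool)
  lits p = Vec.toList (Vec.map just p)

  us-ʳ++ : ∀ r ys → us r ʳ++ ys ≡ us r ++ ys
  us-ʳ++ zero    ys = refl
  us-ʳ++ (suc r) ys = trans (us-ʳ++ r (nothing ∷ ys)) (replicate-++-∷ r nothing)

  -- At `node` the check of `p` is about to begin. At `failed` the subtree is refuted and the second
  -- head stands just behind the markers, on the variable assigned last if there is one.
  node failed : ∀ {i} → i ⊑ n → Vec Bool i → Config M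
  node   e p = config (enter next) X (assigned [] (us (height e) ++ lits p))
  failed e p = config backtracking X (assigned (us (height e)) (lits p))

  skip : ∀ q → q ≡ extending ⊎ q ≡ backtracking → ∀ r zs ys →
    config q X (assigned zs (us r ++ ys)) ⇒⟨ r ⟩ config q X (assigned (us r ʳ++ zs) ys)
  skip q which zero    zs ys = ⇒-refl
  skip q which (suc r) zs ys = skip₁ which ⨾ skip q which r (nothing ∷ zs) ys
    where
    skip₁ : q ≡ extending ⊎ q ≡ backtracking →
      config q X (assigned zs (us (suc r) ++ ys)) ⇒⟨ 1 ⟩ config q X (assigned (nothing ∷ zs) (us r ++ ys))
    skip₁ (inj₁ refl) = ⇒-step refl refl (cong (config extending X) (Assigned.window-right zs nothing _))
    skip₁ (inj₂ refl) = ⇒-step refl refl (cong (config backtracking X) (Assigned.window-right zs nothing _))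

  skip-all : ∀ q → q ≡ extending ⊎ q ≡ backtracking → ∀ r ys →
    config q X (assigned [] (us r ++ ys)) ⇒⟨ r ⟩ config q X (assigned (us r) ys)
  skip-all q which r ys =
    subst (λ zs → config q X (assigned [] (us r ++ ys)) ⇒⟨ r ⟩ config q X (assigned zs ys))
          (trans (us-ʳ++ r []) (++-identityʳ (us r))) (skip q which r [] ys)

  rewind-us : ∀ r ys →
    config (rewind₂ next) X (move left (assigned (us r) ys)) ⇒⟨ suc r ⟩
      config (enter next) X (assigned [] (us r ++ ys))
  rewind-us r ys with rewind₂-run next X (us r) ys
  ... | run rewrite us-ʳ++ r ys | length-replicate r {nothing {A = Bool}} = run

  turn : ∀ {i} zs (p : Vec Bool i) →
    config extending X (assigned zs (lits p)) ⇒⟨ 1 ⟩ config guess X (move left (assigned zs (lits p)))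
  turn zs []      = ⇒-step refl refl refl
  turn zs (_ ∷ _) = ⇒-step refl refl refl

  -- The next variable is the last marker, found by stepping back from the first cell behind the
  -- markers.
  descend : ∀ {i} (e : suc i ⊑ n) p →
    config extending X (assigned [] (us (height (up e)) ++ lits p)) ⇒⟨ n + (2 + n) ⟩ node e (false ∷ p)
  descend {i} e p = ⇒-weaken (+-mono-≤ h≤n (s≤s (s≤s h≤n)))
    (skip-all extending (inj₁ refl) (suc (height e)) (lits p)
     ⨾ turn (us (suc (height e))) p
     ⨾ ⇒-step refl (cong (λ Y → δ guess (Tape.head X ∷ Tape.head Y ∷ [])) (Assigned.window-left nothing (us (height e)) (lits p)))
         (cong (λ Y → config (rewind₂ next) X (act (just (inj₁ false) , left) Y)) (Assigned.window-left nothing (us (height e)) (lits p)))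
     ⨾ rewind-us (height e) (just false ∷ lits p))
    where
    h≤n : suc (height e) ≤ n
    h≤n = m+n≤o⇒m≤o (suc (height e)) (≤-reflexive (height-+ (up e)))

  solved : ∀ (p : Vec Bool n) →
    ∃ λ Y → config extending X (assigned [] (lits p)) ⇒⟨ 2 ⟩ config accept X Y
  solved p = _ , (turn [] p
    ⨾ ⇒-step refl (cong (λ Y → δ guess (Tape.head X ∷ Tape.head Y ∷ [])) (Assigned.window-left-blank (lits p))) refl)

  flip : ∀ {i} (e : suc i ⊑ n) p → failed e (false ∷ p) ⇒⟨ 1 + n ⟩ node e (true ∷ p)
  flip e p = ⇒-weaken (s≤s (m+n≤o⇒m≤o (suc (height e)) (≤-reflexive (height-+ (up e)))))
    (⇒-step refl refl refl ⨾ rewind-us (height e) (just true ∷ lits p))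

  retreat : ∀ {i} (e : suc i ⊑ n) p → failed e (true ∷ p) ⇒⟨ 1 ⟩ failed (up e) p
  retreat e p = ⇒-step refl refl (cong (config backtracking X) (Assigned.window-right (us (height e)) nothing (lits p)))

  checkTime : ℕ
  checkTime = length (kSubsets n (suc k)) * blockTime + (blockTime + length word)

  -- The pass tests the padded assignment against all of `I`; by `consistent-pad` this decides the
  -- sub-instance on the assigned variables.
  check-node : ∀ {i} (e : i ⊑ n) p {b} → alive e p ≡ b →
    node e p ⇒⟨ checkTime ⟩ config (outcome b) X (assigned [] (us (height e) ++ lits p))
  check-node e p refl
    with check (pad e nothing (Vec.map just p)) (kSubsets n (suc k)) [] (length word) ≤-refl
  ... | run rewrite toList-pad e nothing (Vec.map just p) | consistent-pad e (Vec.map just p) = run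

  -- All work at a node outside its subtrees: check, descent, flip and retreat.
  visitTime : ℕ
  visitTime = checkTime + (n + (2 + n) + (1 + n + 1))

  -- Correctness and running time are bundled so that one recursion over the tree proves both.
  data Result {i} (e : i ⊑ n) (p : Vec Bool i) : Set where
    found : ∀ q Y → alive done q ≡ true →
      node e p ⇒⟨ visitTime + load visitTime e p ⟩ config accept X Y → Result e p
    none  : (∀ q → suffix e q ≡ p → alive done q ≡ false) →
      node e p ⇒⟨ visitTime + load visitTime e p ⟩ failed e p → Result e p

  search : ∀ {i} (e : i ⊑ n) p → Result e p
  search-alive : ∀ {i} (e : i ⊑ n) p → alive e p ≡ true → Result e p

  search e p with alive e p in eq
  ... | true  = search-alive e p eq
  ... | false = none dead (⇒-weaken fits (check-node e p eq ⨾ skip-all backtracking (inj₂ refl) (height e) (lits p)))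
    where
    dead : ∀ q → suffix e q ≡ p → alive done q ≡ false
    dead q refl with alive done q in alive-q
    ... | false = refl
    ... | true  = contradiction (trans (sym (alive-suffix e q alive-q)) eq) λ ()
    fits : checkTime + height e ≤ visitTime + load visitTime e p
    fits = ≤-trans (+-monoʳ-≤ checkTime (≤-trans (m+n≤o⇒m≤o (height e) (≤-reflexive (height-+ e)))
      (≤-trans (m≤m+n n _) (m≤m+n _ _)))) (m≤m+n visitTime _)

  search-alive done p eq =
    found p _ eq (⇒-weaken fits (check-node done p eq ⨾ proj₂ (solved p)))
    where
    fits : checkTime + 2 ≤ visitTime + 0
    fits = ≤-trans (+-monoʳ-≤ checkTime (≤-trans (≤-trans (m≤m+n 2 n) (m≤n+m _ n)) (m≤m+n _ _))) (m≤m+n visitTime _)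
  search-alive (up e) p eq = go (search e (false ∷ p)) (search e (true ∷ p))
    where
    c l₀ l₁ : ℕ
    c = visitTime
    l₀ = load visitTime e (false ∷ p)
    l₁ = load visitTime e (true ∷ p)
    load≡ : load c (up e) p ≡ (c + l₀) + (c + l₁)
    load≡ rewrite eq = refl
    to-false : node (up e) p ⇒⟨ checkTime + (n + (2 + n)) ⟩ node e (false ∷ p)
    to-false = check-node (up e) p eq ⨾ descend e p
    -- Here `t` is the work at this node after its check, and `u` the cost of the subtrees, which
    -- `load` covers because the node is alive.
    budget : ∀ {t u} → t ≤ (n + (2 + n)) + (1 + n + 1) → u ≤ (c + l₀) + (c + l₁) →
      (checkTime + t) + u ≤ c + load c (up e) p
    budget t≤ u≤ = +-mono-≤ (+-monoʳ-≤ checkTime t≤) (≤-trans u≤ (≤-reflexive (sym load≡)))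
    to-true : node e (false ∷ p) ⇒⟨ c + l₀ ⟩ failed e (false ∷ p) →
      node (up e) p ⇒⟨ (checkTime + (n + (2 + n) + (1 + n))) + (c + l₀) ⟩ node e (true ∷ p)
    to-true sub = ⇒-weaken (≤-reflexive (regroup checkTime (n + (2 + n)) (1 + n) (c + l₀)))
      (to-false ⨾ sub ⨾ flip e p)
      where
      regroup : ∀ a b d x → a + b + (x + d) ≡ a + (b + d) + x
      regroup = solve-∀
    go : Result e (false ∷ p) → Result e (true ∷ p) → Result (up e) p
    go (found q Y ok sub) _ = found q Y ok (⇒-weaken (budget (m≤m+n _ _) (m≤m+n _ _)) (to-false ⨾ sub))
    go (none _ sub₀) (found q Y ok sub₁) = found q Y ok
      (⇒-weaken (≤-trans (≤-reflexive (+-assoc (checkTime + (n + (2 + n) + (1 + n))) (c + l₀) _))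
          (budget (+-monoʳ-≤ (n + (2 + n)) (m≤m+n _ _)) ≤-refl))
        (to-true sub₀ ⨾ sub₁))
    go (none none₀ sub₀) (none none₁ sub₁) = none neither
      (⇒-weaken (≤-trans (≤-reflexive (regroup checkTime (n + (2 + n)) (1 + n) _ _)) (budget ≤-refl ≤-refl))
        (to-true sub₀ ⨾ sub₁ ⨾ retreat e p))
      where
      regroup : ∀ a b d x y → a + (b + d) + x + (y + 1) ≡ a + (b + (d + 1)) + (x + y)
      regroup = solve-∀
      neither : ∀ q → suffix (up e) q ≡ p → alive done q ≡ false
      -- The first bit of the longer suffix tells which subtree would contain `q`.
      neither q refl with suffix e q in eq
      ... | false ∷ _ = none₀ q eq
      ... | true  ∷ _ = none₁ q eq

  -- Initialisation and total running time

  erase-run : ∀ m B zs →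
    config erase (at B (map (just ∘ inj₁) (replicate m true ++ false ∷ word))) (assigned zs [])
      ⇒⟨ suc m ⟩
    config seekEnd (at (blank ∷ (replicate m blank ʳ++ B)) (map (just ∘ inj₁) word)) (assigned (us m ʳ++ zs) [])
  erase-run zero    B zs =
    ⇒-step refl refl (cong (λ Z → config seekEnd Z (assigned zs [])) (move-right B blank (map (just ∘ inj₁) word)))
  erase-run (suc m) B zs =
    ⇒-step refl refl (cong (λ Z → config erase Z (assigned (nothing ∷ zs) [])) (move-right B blank _))
    ⨾ erase-run m (blank ∷ B) (nothing ∷ zs)

  seek-run : ∀ xs ys Y →
    config seekEnd (at (map (just ∘ inj₁) xs ++ blank ∷ far) (map (just ∘ inj₁) ys)) Y ⇒⟨ suc (length ys) ⟩
      config (rewind next) (move left (window (ys ʳ++ xs) [])) Y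
  seek-run xs []       Y = ⇒-step refl refl refl
  seek-run xs (y ∷ ys) Y =
    ⇒-step refl refl (cong (λ Z → config seekEnd Z Y) (move-right _ _ (map (just ∘ inj₁) ys)))
    ⨾ seek-run (y ∷ xs) ys Y

  initTime : ℕ
  initTime = 1 + (suc n + (suc (length word) + (suc (length word) + suc n)))

  init-run : initial M (encode I) ⇒⟨ initTime ⟩ node root []
  init-run rewrite inputTape-at (map (λ b → just (inj₁ {B = ⊤} b)) (encode I)) =
    ⇒-step refl refl refl ⨾ erase-run n [] [] ⨾ seek-run [] word _ ⨾ rewinding
    where
    rewinding : config (rewind next) (move left (window (word ʳ++ []) [])) (assigned (us n ʳ++ []) [])
      ⇒⟨ suc (length word) + suc n ⟩ node root []
    rewinding with rewind-run next (word ʳ++ []) [] (us n ʳ++ []) []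
    ... | run rewrite ʳ++-involutive word | ʳ++-involutive (us n)
                    | length-ʳ++ word {[]} | length-ʳ++ (us n) {[]}
                    | length-replicate n {nothing {A = Bool}} | +-identityʳ n | +-identityʳ (length word)
                    | trans (sym (+-identityʳ (height (root {n})))) (height-+ (root {n}))
                    | ++-identityʳ (us n) = run

  -- The final unit is the step to `reject` from the failed root, where the second head is on the
  -- blank behind all markers.
  totalTime : ℕ
  totalTime = initTime + (visitTime + load visitTime root []) + 1

  -- All blocks have the same length, so the time bounds depend on the instance only through `n` and
  -- `k`.
  length-word : length word ≡ length (kSubsets n (suc k)) * (n + tableLength)
  length-word = length-concatMap (kSubsets n (suc k))
    where
    length-concatMap : ∀ Ss → length (concatMap block Ss) ≡ length Ss * (n + tableLength)
    length-concatMap []       = refl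
    length-concatMap (S ∷ Ss) =
      trans (length-++ (block S)) (cong₂ _+_ (length-block S) (length-concatMap Ss))

  decide : ∀ {T} → totalTime ≤ T → ∃ λ b → run M T (encode I) ≡ just b × Reflects (Satisfiable I) b
  decide T≥ with search root []
  ... | found q Y ok sub = true , ⇒-halt {w = encode I} refl (init-run ⨾ sub) (≤-trans (m≤m+n _ 1) T≥) ,
                           ofʸ (q , consistent⇒ I q ok)
  ... | none dead sub = false , ⇒-halt {w = encode I} refl ((init-run ⨾ sub) ⨾ ⇒-step refl refl refl) T≥ ,
      ofⁿ λ { (q , sat) → contradiction (trans (sym (⇒consistent I q sat)) (dead q (nullary (suffix root q)))) λ () }
    where
    nullary : (v : Vec Bool 0) → v ≡ []
    nullary [] = refl

-- The polynomial time bound and the theorem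

poly-total : ∀ k → ∃ λ f → Polynomial f × (∀ n (I : CompleteCSP (suc k) n) → Solve.totalTime I ≤ f n)
poly-total k = total , poly , bound
  where
  open Machine (suc k) using (tableLength)
  -- The number of constraints, the length of `word`, `blockTime` and `visitTime`, as functions of
  -- `n` alone.
  L W B V : ℕ → ℕ
  L n = length (kSubsets n (suc k))
  W n = L n * (n + tableLength)
  B n = n + suc (suc (tableLength + suc n))
  V n = L n * B n + (B n + W n) + (n + (2 + n) + (1 + n + 1))
  init total : ℕ → ℕ
  init n = 1 + (suc n + (suc (W n) + (suc (W n) + suc n)))
  total n = init n + (V n + n * (2 * V n * suc n ^ suc k)) + 1
  polyL : Polynomial L
  polyL = poly-≤ (λ n → length-kSubsets n (suc k)) (poly-suc^ (suc k))
  polyW : Polynomial W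
  polyW = polyL poly-* (poly-id poly-+ poly-const tableLength)
  poly-suc : ∀ {f} → Polynomial f → Polynomial (suc ∘ f)
  poly-suc p = poly-const 1 poly-+ p
  polyB : Polynomial B
  polyB = poly-id poly-+ poly-suc (poly-suc (poly-const tableLength poly-+ poly-suc poly-id))
  polyV : Polynomial V
  polyV = polyL poly-* polyB poly-+ (polyB poly-+ polyW)
    poly-+ (poly-id poly-+ (poly-const 2 poly-+ poly-id) poly-+ (poly-suc poly-id poly-+ poly-const 1))
  poly : Polynomial total
  poly = poly-suc (poly-suc poly-id poly-+ (poly-suc polyW poly-+ (poly-suc polyW poly-+ poly-suc poly-id)))
    poly-+ (polyV poly-+ poly-id poly-* (poly-const 2 poly-* polyV poly-* poly-suc^ (suc k))) poly-+ poly-const 1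
  bound : ∀ n (I : CompleteCSP (suc k) n) → Solve.totalTime I ≤ total n
  bound n I = +-monoˡ-≤ 1 (+-mono-≤ (≤-reflexive init≡) (+-mono-≤ (≤-reflexive visit≡)
      (≤-trans (load-root visitTime) (≤-reflexive (cong (λ v → n * (2 * v * suc n ^ suc k)) visit≡)))))
    where
    open Solve I
    open Search I using (load-root)
    init≡ : initTime ≡ init n
    init≡ = cong (λ w → 1 + (suc n + (suc w + (suc w + suc n)))) length-word
    visit≡ : visitTime ≡ V n
    visit≡ = cong (λ w → L n * B n + (B n + w) + (n + (2 + n) + (1 + n + 1))) length-word

theorem1p2 : (k : ℕ) → 2 ≤ k →
    ∃ λ (M : TM) → ∃ λ (c : ℕ) → ∃ λ (d : ℕ) →
    (n : ℕ) (I : CompleteCSP k n) →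
    ∃ λ (b : Bool) →
    run M (c * suc n ^ d) (encode I) ≡ just b × Reflects (Satisfiable I) b
theorem1p2 (suc k) _ =
  let f , (c , d , f≤) , total≤ = poly-total k in
  Machine.M (suc k) , c , d , λ n I → Solve.decide I {c * suc n ^ d} (≤-trans (total≤ n I) (f≤ n))
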